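{- Let $N$ be a set, let $n$ be a natural number, and let $\overline{X}=(X_1,\dots,X_n)$ and $\overline{Y}=(Y_1,\dots,Y_n)$ be $n$-tuples of nonempty subsets of $N$. Then $\overline{X}\sqsubseteq\overline{Y}$ if and only if there exists an increasing, contractive function $f:\mathbf{B}^n\to\mathbf{B}^n$ such that $\overline{X}\subseteq\widehat{f}(\overline{Y})$.
   Context: Sections and the preorder: an $n$-multiset of elements of $N$ is an orbit of the action of the symmetric group $S_n$ on $N^n$ by permuting coordinates. For an $n$-tuple $\overline{X}$ of nonempty subsets of $N$, $\mathcal{S}(\overline{X})$ is the set of all $n$-multisets that are orbits of tuples $(a_1,\dots,a_n)\in\prod_{1\le i\le n}X_i$. The relation $\overline{X}\sqsubseteq\overline{Y}$ means $\mathcal{S}(\overline{X})\subseteq\mathcal{S}(\overline{Y})$. The relation $\overline{X}\subseteq\overline{Z}$ between $n$-tuples of subsets of $N$ is pointwise inclusion: $X_i\subseteq Z_i$ for all $1\le i\le n$. Boolean operators: $\mathbf{B}=\{0,1\}$ with $0\le 1$, and $\mathbf{B}^n$ carries the pointwise order. The weight $|u|$ of $u\in\mathbf{B}^n$ is the number of $1$s in $u$. A function $f:\mathbf{B}^n\to\mathbf{B}^n$ is increasing if $u\le v$ implies $f(u)\le f(v)$; an increasing $f$ is contractive if $|f(u)|\le|u|$ for all $u\in\mathbf{B}^n$. Lifting: for $a\in N$ and an $n$-tuple $\overline{Y}$ of subsets of $N$, $\chi_{\overline{Y}}(a)\in\mathbf{B}^n$ is defined by $(\chi_{\overline{Y}}(a))_i=1$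 iff $a\in Y_i$. For $f:\mathbf{B}^n\to\mathbf{B}^n$, $\widehat{f}(\overline{Y})$ is the $n$-tuple of (possibly empty) subsets of $N$ whose $i$-th component is $\{a\in N : f(\chi_{\overline{Y}}(a)) \text{ has a } 1 \text{ at coordinate } i\}$. -}

module Defs where

open import Level using (Level; 0ℓ; suc; _⊔_)
open import Axiom.ExcludedMiddle using (ExcludedMiddle)
open import Data.Bool.Base as Bool using (Bool; true)
open import Data.Fin.Subset using (∣_∣)
open import Data.Nat.Base as ℕ using (ℕ)
open import Data.Product.Base using (Σ-syntax; _×_)
open import Data.Vec.Base using (Vec; lookup; tabulate)
open import Data.Vec.Functional using (Vector)
open import Data.Vec.Functional.Relation.Binary.Permutation using (_↭_)
open import Data.Vec.Relation.Binary.Pointwise.Inductive using (Pointwise)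
open import Relation.Binary.PropositionalEquality.Core using (_≡_)
open import Relation.Nullary.Decidable.Core using (does)
open import Relation.Unary using (Pred; _∈_; _⊆_; _≐_; Satisfiable)

private
  variable
    ℓ ℓ₁ ℓ₂ : Level
    n : ℕ

SubsetTuple : Set ℓ → ℕ → Set (suc ℓ)
SubsetTuple {ℓ} N n = Vector (Pred N ℓ) n

AllNonempty : {N : Set ℓ} → SubsetTuple N n → Set ℓ
AllNonempty X = ∀ i → Satisfiable (X i)

infix 4 _⊆ᵗ_ _⊑_ _≤ᴮ_

_⊆ᵗ_ : {N : Set ℓ} → Vector (Pred N ℓ₁) n → Vector (Pred N ℓ₂) n →
       Set (ℓ ⊔ ℓ₁ ⊔ ℓ₂)
X ⊆ᵗ Z = ∀ i → X i ⊆ Z i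

-- The orbit of a tuple under Sₙ, as a subset of Nⁿ.
orbit : {N : Set ℓ} → Vector N n → Pred (Vector N n) ℓ
orbit a b = a ↭ b

-- The set of multisets is a set of subsets of Nⁿ, taken up to
-- extensional equality of subsets.
𝒮 : {N : Set ℓ} → SubsetTuple N n → Pred (Pred (Vector N n) ℓ) ℓ
𝒮 {n = n} {N = N} X M = Σ[ a ∈ Vector N n ] (∀ i → a i ∈ X i) × M ≐ orbit a

_⊑_ : {N : Set ℓ} → SubsetTuple N n → SubsetTuple N n → Set (suc ℓ)
X ⊑ Y = 𝒮 X ⊆ 𝒮 Y

_≤ᴮ_ : Vec Bool n → Vec Bool n → Set
_≤ᴮ_ = Pointwise Bool._≤_

Increasing : (Vec Bool n → Vec Bool n) → Set
Increasing f = ∀ u v → u ≤ᴮ v → f u ≤ᴮ f v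

-- ∣ u ∣ is the cardinality of u read as a subset of Fin n, i.e. the
-- number of its coordinates equal to true.
Contractive : (Vec Bool n → Vec Bool n) → Set
Contractive f = ∀ u → ∣ f u ∣ ℕ.≤ ∣ u ∣

-- Subsets are arbitrary predicates, so a Boolean-valued characteristic
-- function exists only classically.
χ : ExcludedMiddle ℓ → {N : Set ℓ} → SubsetTuple N n → N → Vec Bool n
χ em Y a = tabulate λ i → does (em {a ∈ Y i})

lifting : ExcludedMiddle ℓ → (Vec Bool n → Vec Bool n) →
          {N : Set ℓ} → SubsetTuple N n → Vector (Pred N 0ℓ) n
lifting em f Y i a = lookup (f (χ em Y a)) i ≡ true

{-# OPTIONS --safe #-}

-- For the forward direction take for f the least increasing map whose lifting
-- covers X: f u has a 1 at i iff some a ∈ Xᵢ satisfies χ(a) ≤ u.  Picking such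
-- an a at every 1 of f u, and any point of Xᵢ elsewhere, gives a tuple in ∏ X;
-- a permutation moving it into ∏ Y sends the 1s of f u injectively to 1s of u.
--
-- Conversely, a tuple in ∏ X can be permuted into ∏ Y iff the sets χ(aᵢ) have a
-- system of distinct representatives.  Hall's condition holds: if χ(aᵢ) ≤ T for
-- all i ∈ S then S ≤ f T, since f is increasing, so ∣S∣ ≤ ∣f T∣ ≤ ∣T∣.
module Submission where

open import Defs
open import Level using (Level)
open import Axiom.ExcludedMiddle using (ExcludedMiddle)
open import Data.Bool.Base as Bool using (Bool; true; false)
open import Data.Fin.Base using (Fin; zero; suc; punchOut)
open import Data.Fin.Permutation
  using (Permutation′; permutation; _⟨$⟩ʳ_; _⟨$⟩ˡ_; inverseʳ; flip)
open import Data.Fin.Properties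
  using (any?; all?; _≟_; suc-injective; 0≢1+n; punchOut-injective; injective⇒≤)
open import Data.Fin.Subset
  using (Subset; inside; outside; ⊥; ⁅_⁆; _∪_; _∩_; _-_; ∣_∣; _∈_; _⊆_)
open import Data.Fin.Subset.Properties
open import Data.Nat.Base using (ℕ; zero; suc; _+_; _≤_; _<_; z≤n)
open import Data.Nat.Properties
  using (≤-trans; ≤-reflexive; ≤-<-trans; <-irrefl; ≮⇒≥; 1+n≰n; _<?_;
         +-mono-≤; +-monoʳ-≤; +-cancelʳ-≤; +-suc; +-comm; m≤m+n; module ≤-Reasoning)
open import Data.Product.Base using (Σ-syntax; ∃; ∃₂; _×_; _,_; proj₁; proj₂)
open import Data.Sum.Base using ([_,_]′)
open import Data.Vec.Base using (Vec; []; _∷_; tabulate; here; there)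
open import Data.Vec.Functional.Relation.Binary.Permutation.Properties
  using (↭-refl; ↭-sym; ↭-trans)
open import Data.Vec.Properties using (lookup∘tabulate; []=⇒lookup; lookup⇒[]=)
open import Data.Vec.Relation.Binary.Pointwise.Inductive using ([]; _∷_)
open import Function.Base using (_∘_; _$_)
open import Function.Bundles using (_⇔_; mk⇔; Injection)
open import Function.Definitions using (Injective)
open import Function.Properties.Inverse using (↔⇒↣)
open import Relation.Binary.PropositionalEquality
  using (_≡_; _≢_; refl; sym; trans; cong; subst)
open import Relation.Nullary.Decidable
  using (Dec; yes; no; does; _×-dec_; _→-dec_; ¬?; dec-true; decidable-stable)
open import Relation.Nullary.Negation using (¬_; contradiction)

private
  variable
    ℓ : Level
    k m n : ℕ

-- Cardinalities of finite subsets and injections between finite sets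

∣p∪q∣+∣p∩q∣≡∣p∣+∣q∣ : (p q : Subset n) → ∣ p ∪ q ∣ + ∣ p ∩ q ∣ ≡ ∣ p ∣ + ∣ q ∣
∣p∪q∣+∣p∩q∣≡∣p∣+∣q∣ []            []            = refl
∣p∪q∣+∣p∩q∣≡∣p∣+∣q∣ (outside ∷ p) (outside ∷ q) = ∣p∪q∣+∣p∩q∣≡∣p∣+∣q∣ p q
∣p∪q∣+∣p∩q∣≡∣p∣+∣q∣ (inside  ∷ p) (outside ∷ q) = cong suc (∣p∪q∣+∣p∩q∣≡∣p∣+∣q∣ p q)
∣p∪q∣+∣p∩q∣≡∣p∣+∣q∣ (outside ∷ p) (inside  ∷ q) =
  trans (cong suc (∣p∪q∣+∣p∩q∣≡∣p∣+∣q∣ p q)) (sym (+-suc ∣ p ∣ ∣ q ∣))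
∣p∪q∣+∣p∩q∣≡∣p∣+∣q∣ (inside  ∷ p) (inside  ∷ q) = cong suc $
  trans (+-suc ∣ p ∪ q ∣ ∣ p ∩ q ∣)
    (trans (cong suc (∣p∪q∣+∣p∩q∣≡∣p∣+∣q∣ p q)) (sym (+-suc ∣ p ∣ ∣ q ∣)))

∣p∪⁅x⁆∣≤1+∣p∣ : (p : Subset n) (x : Fin n) → ∣ p ∪ ⁅ x ⁆ ∣ ≤ suc ∣ p ∣
∣p∪⁅x⁆∣≤1+∣p∣ p x = begin
  ∣ p ∪ ⁅ x ⁆ ∣                  ≤⟨ m≤m+n _ _ ⟩
  ∣ p ∪ ⁅ x ⁆ ∣ + ∣ p ∩ ⁅ x ⁆ ∣  ≡⟨ ∣p∪q∣+∣p∩q∣≡∣p∣+∣q∣ p ⁅ x ⁆ ⟩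
  ∣ p ∣ + ∣ ⁅ x ⁆ ∣              ≡⟨ cong (∣ p ∣ +_) (∣⁅x⁆∣≡1 x) ⟩
  ∣ p ∣ + 1                      ≡⟨ +-comm ∣ p ∣ 1 ⟩
  suc ∣ p ∣                      ∎
  where open ≤-Reasoning

x∉p-x : (p : Subset n) (x : Fin n) → ¬ (x ∈ p - x)
x∉p-x (_ ∷ p) zero    ()
x∉p-x (_ ∷ p) (suc x) (there x∈p-x) = x∉p-x p x x∈p-x

p-x⊆q⇒p⊆q∪⁅x⁆ : {p q : Subset n} (x : Fin n) → p - x ⊆ q → p ⊆ q ∪ ⁅ x ⁆
p-x⊆q⇒p⊆q∪⁅x⁆ {q = q} x p-x⊆q {y} y∈p with y ≟ x
... | yes refl = q⊆p∪q q ⁅ x ⁆ (x∈⁅x⁆ x)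
... | no  y≢x  = p⊆p∪q ⁅ x ⁆ (p-x⊆q (x∈p∧x≢y⇒x∈p-y y∈p y≢x))

-- Each member of `p` uses up its image: `f zero` is removed from `q`, and injectivity keeps the
-- later images clear of it.
injective⇒∣p∣≤∣q∣ : (p : Subset m) (q : Subset n) {f : Fin m → Fin n} → Injective _≡_ _≡_ f →
                    (∀ {i} → i ∈ p → f i ∈ q) → ∣ p ∣ ≤ ∣ q ∣
injective⇒∣p∣≤∣q∣ []            q f-inj f[p]⊆q = z≤n
injective⇒∣p∣≤∣q∣ (outside ∷ p) q f-inj f[p]⊆q =
  injective⇒∣p∣≤∣q∣ p q (suc-injective ∘ f-inj) (f[p]⊆q ∘ there)
injective⇒∣p∣≤∣q∣ (inside  ∷ p) q {f} f-inj f[p]⊆q = ≤-<-trans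
  (injective⇒∣p∣≤∣q∣ p (q - f zero) (suc-injective ∘ f-inj)
    (λ i∈p → x∈p∧x≢y⇒x∈p-y (f[p]⊆q (there i∈p)) (λ eq → 0≢1+n (sym (f-inj eq)))))
  (x∈p⇒∣p-x∣<∣p∣ (f[p]⊆q here))

-- Punching a missed `j` out of the codomain would leave an injection from `suc n` points into `n`.
injective⇒surjective : {f : Fin n → Fin n} → Injective _≡_ _≡_ f → ∀ j → ∃ λ i → f i ≡ j
injective⇒surjective {suc n} {f} f-inj j with any? (λ i → f i ≟ j)
... | yes i,fi≡j = i,fi≡j
... | no  j∉f    = contradiction
  (injective⇒≤ (f-inj ∘ punchOut-injective (missed _) (missed _))) 1+n≰n
  where
  missed : ∀ i → j ≢ f i
  missed i j≡fi = j∉f (i , sym j≡fi)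

injective⇒permutation : (f : Fin n → Fin n) → Injective _≡_ _≡_ f → Permutation′ n
injective⇒permutation f f-inj =
  permutation f (proj₁ ∘ f-surj) (proj₂ ∘ f-surj) (f-inj ∘ proj₂ ∘ f-surj ∘ f)
  where f-surj = injective⇒surjective f-inj

-- Hall's theorem

Covers : (Fin m → Subset n) → Subset m → Subset n → Set
Covers A S T = ∀ i → i ∈ S → A i ⊆ T

-- Quantifying over all T covering the sets indexed by S, rather than taking
-- T to be their union, spares the union.
HallCondition : (Fin m → Subset n) → Set
HallCondition A = ∀ S T → Covers A S T → ∣ S ∣ ≤ ∣ T ∣

-- Under the Hall condition the inequality becomes an equality: `T` is a cover with no element to
-- spare.
Tight : (Fin m → Subset n) → Subset m → Subset n → Set
Tight A S T = Covers A S T × ∣ T ∣ ≤ ∣ S ∣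

Deficient : (Fin m → Subset n) → Set
Deficient A = ∃₂ λ S T → Covers A S T × ∣ T ∣ < ∣ S ∣

-- A violation of the Hall condition ranges over finitely many pairs of subsets, so exhaustive
-- search either finds one or establishes the condition.
deficient? : (A : Fin m → Subset n) → Dec (Deficient A)
deficient? A = anySubset? λ S → anySubset? λ T →
  all? (λ i → (i ∈? S) →-dec (A i ⊆? T)) ×-dec (∣ T ∣ <? ∣ S ∣)

tight-⊥ : (A : Fin m → Subset n) → Tight A ⊥ ⊥
tight-⊥ {m} {n} A =
  (λ _ i∈⊥ → contradiction i∈⊥ ∉⊥) , ≤-reflexive (trans (∣⊥∣≡0 n) (sym (∣⊥∣≡0 m)))

-- Cardinality is modular, and `T ∩ T′` covers `S ∩ S′`. The Hall condition there bounds the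
-- intersections in the direction that lets them cancel, leaving the bound for the unions.
tight-∪ : {A : Fin m → Subset n} → HallCondition A → ∀ {S S′ T T′} →
          Tight A S T → Tight A S′ T′ → Tight A (S ∪ S′) (T ∪ T′)
tight-∪ {A = A} hall {S} {S′} {T} {T′} (cov , ∣T∣≤∣S∣) (cov′ , ∣T′∣≤∣S′∣) =
  cov-∪ , +-cancelʳ-≤ ∣ S ∩ S′ ∣ _ _ (begin
    ∣ T ∪ T′ ∣ + ∣ S ∩ S′ ∣  ≤⟨ +-monoʳ-≤ ∣ T ∪ T′ ∣ (hall _ _ cov-∩) ⟩
    ∣ T ∪ T′ ∣ + ∣ T ∩ T′ ∣  ≡⟨ ∣p∪q∣+∣p∩q∣≡∣p∣+∣q∣ T T′ ⟩
    ∣ T ∣ + ∣ T′ ∣           ≤⟨ +-mono-≤ ∣T∣≤∣S∣ ∣T′∣≤∣S′∣ ⟩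
    ∣ S ∣ + ∣ S′ ∣           ≡⟨ ∣p∪q∣+∣p∩q∣≡∣p∣+∣q∣ S S′ ⟨
    ∣ S ∪ S′ ∣ + ∣ S ∩ S′ ∣  ∎)
  where
  open ≤-Reasoning
  cov-∪ : Covers A (S ∪ S′) (T ∪ T′)
  cov-∪ i i∈S∪S′ x∈Ai =
    [ (λ i∈S → p⊆p∪q T′ (cov i i∈S x∈Ai)) , (λ i∈S′ → q⊆p∪q T T′ (cov′ i i∈S′ x∈Ai)) ]′
      (x∈p∪q⁻ S S′ i∈S∪S′)
  cov-∩ : Covers A (S ∩ S′) (T ∩ T′)
  cov-∩ i i∈S∩S′ x∈Ai with i∈S , i∈S′ ← x∈p∩q⁻ S S′ i∈S∩S′ =
    x∈p∩q⁺ (cov i i∈S x∈Ai , cov′ i i∈S′ x∈Ai)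

tight-⋃ : {A : Fin m → Subset n} → HallCondition A →
          (T : Fin k → Subset n) → (∀ j → ∃ λ S → Tight A S (T j)) →
          ∃₂ λ S′ T′ → Tight A S′ T′ × (∀ j → T j ⊆ T′)
tight-⋃ {k = zero}  {A} hall T tight = ⊥ , ⊥ , tight-⊥ A , λ ()
tight-⋃ {k = suc k} hall T tight
  with S′ , T′ , tight′ , T⊆T′ ← tight-⋃ hall (T ∘ suc) (tight ∘ suc) =
  _ , T zero ∪ T′ , tight-∪ hall (proj₂ (tight zero)) tight′ , λ where
    zero    → p⊆p∪q T′
    (suc j) → q⊆p∪q (T zero) T′ ∘ T⊆T′ j

-- If no x ∈ A₀ could be chosen, every x ∈ A₀ would lie in the cover T of a
-- tight S; the union of these would be tight with A₀ ⊆ T, so that adjoining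
-- the index 0 to S would violate the condition.
hall-choose : (A : Fin (suc m) → Subset n) → HallCondition A →
              ∃ λ x → x ∈ A zero × HallCondition (λ i → A (suc i) - x)
hall-choose {m} {n} A hall
  with any? (λ x → (x ∈? A zero) ×-dec ¬? (deficient? (λ i → A (suc i) - x)))
... | yes (x , x∈A₀ , ¬def) =
  x , x∈A₀ , λ S T cov → ≮⇒≥ (λ ∣T∣<∣S∣ → ¬def (S , T , cov , ∣T∣<∣S∣))
... | no  noChoice =
  let S , T , (cov , ∣T∣≤∣S∣) , T⊆ =
        tight-⋃ hall′ (proj₁ ∘ tightAt) (proj₁ ∘ proj₂ ∘ tightAt)
      A₀⊆T = λ {x} x∈A₀ → T⊆ x (proj₂ (proj₂ (tightAt x)) x∈A₀)
      ∣S∣<∣T∣ = hall (inside ∷ S) T λ where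
        zero    _           → A₀⊆T
        (suc i) (there i∈S) → cov i i∈S
  in  contradiction (≤-trans ∣S∣<∣T∣ ∣T∣≤∣S∣) (<-irrefl refl)
  where
  A′ : Fin m → Subset n
  A′ = A ∘ suc
  hall′ : HallCondition A′
  hall′ S T cov = hall (outside ∷ S) T λ where (suc i) (there i∈S) → cov i i∈S
  tightAt : ∀ x → ∃ λ T → (∃ λ S → Tight A′ S T) × (x ∈ A zero → x ∈ T)
  tightAt x with x ∈? A zero
  -- Outside `A zero` the empty pair serves as a default, so that the union can run over all of
  -- `Fin n`.
  ... | no  x∉A₀ = ⊥ , (⊥ , tight-⊥ A′) , λ x∈A₀ → contradiction x∈A₀ x∉A₀
  ... | yes x∈A₀
    with S , T , cov , ∣T∣<∣S∣ ←
      decidable-stable (deficient? (λ i → A′ i - x)) (λ ¬def → noChoice (x , x∈A₀ , ¬def)) =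
    -- Restoring `x` to the sets enlarges the cover by at most one element, which the strict
    -- inequality of the deficiency absorbs.
    T ∪ ⁅ x ⁆ ,
    (S , (λ i i∈S → p-x⊆q⇒p⊆q∪⁅x⁆ x (cov i i∈S)) , ≤-trans (∣p∪⁅x⁆∣≤1+∣p∣ T x) ∣T∣<∣S∣) ,
    λ _ → q⊆p∪q T ⁅ x ⁆ (x∈⁅x⁆ x)

-- Induction on the number of sets: `hall-choose` gives a representative of the first set whose
-- deletion from the others preserves the Hall condition, and the deletion makes the representatives
-- distinct.
hall-marriage : (A : Fin m → Subset n) → HallCondition A →
                ∃ λ (f : Fin m → Fin n) → Injective _≡_ _≡_ f × (∀ i → f i ∈ A i)
hall-marriage {zero}  A hall = (λ ()) , (λ { {()} }) , λ ()
hall-marriage {suc m} {n} A hall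
  with x , x∈A₀ , hall′ ← hall-choose A hall
  with f , f-inj , f∈A-x ← hall-marriage (λ i → A (suc i) - x) hall′
  = g , g-inj , g∈A
  where
  x≢f : ∀ i → x ≢ f i
  x≢f i x≡fi = x∉p-x (A (suc i)) x (subst (_∈ A (suc i) - x) (sym x≡fi) (f∈A-x i))
  g : Fin (suc m) → Fin n
  g zero    = x
  g (suc i) = f i
  g-inj : Injective _≡_ _≡_ g
  g-inj {zero}  {zero}  _  = refl
  g-inj {zero}  {suc j} eq = contradiction eq (x≢f j)
  g-inj {suc i} {zero}  eq = contradiction (sym eq) (x≢f i)
  g-inj {suc i} {suc j} eq = cong suc (f-inj eq)
  g∈A : ∀ i → g i ∈ A i
  g∈A zero    = x∈A₀
  g∈A (suc i) = p─q⊆p (A (suc i)) ⁅ x ⁆ (f∈A-x i)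

-- Boolean vectors as subsets

≤ᴮ⇒⊆ : {u v : Vec Bool n} → u ≤ᴮ v → u ⊆ v
≤ᴮ⇒⊆ (Bool.b≤b ∷ _) here        = here
≤ᴮ⇒⊆ (_ ∷ u≤v)      (there i∈u) = there (≤ᴮ⇒⊆ u≤v i∈u)

⊆⇒≤ᴮ : {u v : Vec Bool n} → u ⊆ v → u ≤ᴮ v
⊆⇒≤ᴮ {u = []}        {[]}        u⊆v = []
⊆⇒≤ᴮ {u = true  ∷ u} {true  ∷ v} u⊆v = Bool.b≤b ∷ ⊆⇒≤ᴮ (drop-∷-⊆ u⊆v)
⊆⇒≤ᴮ {u = true  ∷ u} {false ∷ v} u⊆v = contradiction (u⊆v here) λ ()
⊆⇒≤ᴮ {u = false ∷ u} {true  ∷ v} u⊆v = Bool.f≤t ∷ ⊆⇒≤ᴮ (drop-∷-⊆ u⊆v)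
⊆⇒≤ᴮ {u = false ∷ u} {false ∷ v} u⊆v = Bool.b≤b ∷ ⊆⇒≤ᴮ (drop-∷-⊆ u⊆v)

module _ {P : Fin n → Set ℓ} (P? : ∀ i → Dec (P i)) where

  ∈-tabulate⁺ : ∀ {i} → P i → i ∈ tabulate (does ∘ P?)
  ∈-tabulate⁺ {i} Pi =
    lookup⇒[]= i _ (trans (lookup∘tabulate (does ∘ P?) i) (dec-true (P? i) Pi))

  ∈-tabulate⁻ : ∀ {i} → i ∈ tabulate (does ∘ P?) → P i
  ∈-tabulate⁻ {i} i∈ with P? i | trans (sym (lookup∘tabulate (does ∘ P?) i)) ([]=⇒lookup i∈)
  ... | yes Pi | _  = Pi
  ... | no  _  | ()

-- The preorder on tuples and Boolean operators

module _ (em : ExcludedMiddle ℓ) {N : Set ℓ} {n : ℕ} (X Y : SubsetTuple N n) where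

  -- The orbit of `a` is also the orbit of some `b` in the product of `Y`; since `a` lies in its own
  -- orbit, it is a rearrangement of `b`.
  ⊑⇒permutation : X ⊑ Y → (a : Fin n → N) → (∀ i → X i (a i)) →
                  Σ[ π ∈ Permutation′ n ] (∀ i → Y (π ⟨$⟩ʳ i) (a i))
  ⊑⇒permutation X⊑Y a a∈X
    with b , b∈Y , a≐b ← X⊑Y {orbit a} (a , a∈X , (λ z → z) , (λ z → z))
    with π , bπ≡a ← proj₁ a≐b (↭-refl {x = a}) =
    π , λ i → subst (Y (π ⟨$⟩ʳ i)) (bπ≡a i) (b∈Y (π ⟨$⟩ʳ i))

  permutation⇒⊑ : ((a : Fin n → N) → (∀ i → X i (a i)) →
                   Σ[ π ∈ Permutation′ n ] (∀ i → Y (π ⟨$⟩ʳ i) (a i))) → X ⊑ Y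
  permutation⇒⊑ permute (a , a∈X , M⊆a , a⊆M) with π , a∈Yπ ← permute a a∈X =
    b , (λ i → subst (λ j → Y j (b i)) (inverseʳ π) (a∈Yπ (π ⟨$⟩ˡ i))) ,
    (λ c∈M → ↭-trans {i = n} {i = b} (↭-sym {x = a} {b} a↭b) (M⊆a c∈M)) ,
    (λ b↭c → a⊆M (↭-trans {i = n} {i = a} a↭b b↭c))
    where
    b : Fin n → N
    -- Since `π` sends the index of an entry of `a` to its slot in `Y`, the entry at slot `i` is
    -- read off through the inverse.
    b i = a (π ⟨$⟩ˡ i)
    a↭b : orbit a b
    a↭b = flip π , λ _ → refl

  Reaches : Vec Bool n → Fin n → Set ℓ
  Reaches u i = Σ[ a ∈ N ] X i a × χ em Y a ⊆ u

  leastOperator : Vec Bool n → Vec Bool n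
  leastOperator u = tabulate λ i → does (em {Reaches u i})

  leastOperator-increasing : Increasing leastOperator
  leastOperator-increasing u v u≤v = ⊆⇒≤ᴮ λ i∈fu →
    let a , a∈Xi , χa⊆u = ∈-tabulate⁻ (λ i → em {Reaches u i}) i∈fu
    in  ∈-tabulate⁺ (λ i → em {Reaches v i}) (a , a∈Xi , λ x → ≤ᴮ⇒⊆ u≤v (χa⊆u x))

  leastOperator-contractive : AllNonempty X → X ⊑ Y → Contractive leastOperator
  leastOperator-contractive X≢∅ X⊑Y u = injective⇒∣p∣≤∣q∣ (leastOperator u) u π-inj λ {i} i∈fu →
    -- As `a i` lies in `Y` at `π i`, the index `π i` belongs to `χ em Y (a i)`, hence to `u`.
    proj₂ (proj₂ (pick i)) i∈fu (∈-tabulate⁺ (λ j → em {Y j (a i)}) (a∈Yπ i))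
    where
    pick : ∀ i → ∃ λ a → X i a × (i ∈ leastOperator u → χ em Y a ⊆ u)
    pick i with i ∈? leastOperator u
    ... | yes i∈fu = let a , a∈Xi , χa⊆u = ∈-tabulate⁻ (λ i → em {Reaches u i}) i∈fu
                     in  a , a∈Xi , λ _ → χa⊆u
    -- Any point of `X i` will do here; it only completes the tuple.
    ... | no  i∉fu = let a , a∈Xi = X≢∅ i
                     in  a , a∈Xi , λ i∈fu → contradiction i∈fu i∉fu
    a : Fin n → N
    a = proj₁ ∘ pick
    π,a∈Yπ = ⊑⇒permutation X⊑Y a (λ i → proj₁ (proj₂ (pick i)))
    π = proj₁ π,a∈Yπ
    a∈Yπ = proj₂ π,a∈Yπ
    π-inj : Injective _≡_ _≡_ (π ⟨$⟩ʳ_)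
    π-inj = Injection.injective (↔⇒↣ π)

  ⊆-lifting-leastOperator : X ⊆ᵗ lifting em leastOperator Y
  ⊆-lifting-leastOperator i {a} a∈Xi =
    []=⇒lookup (∈-tabulate⁺ (λ i → em {Reaches (χ em Y a) i}) (a , a∈Xi , λ x → x))

  χ-hallCondition : {f : Vec Bool n → Vec Bool n} → Increasing f → Contractive f →
                    X ⊆ᵗ lifting em f Y → (a : Fin n → N) → (∀ i → X i (a i)) →
                    HallCondition (λ i → χ em Y (a i))
  χ-hallCondition {f} f-incr f-contr X⊆f̂Y a a∈X S T cov =
    ≤-trans (p⊆q⇒∣p∣≤∣q∣ S⊆fT) (f-contr T)
    where
    S⊆fT : S ⊆ f T
    S⊆fT {i} i∈S = ≤ᴮ⇒⊆ (f-incr _ T (⊆⇒≤ᴮ (cov i i∈S))) (lookup⇒[]= i _ (X⊆f̂Y i (a∈X i)))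

  lifting⇒⊑ : {f : Vec Bool n → Vec Bool n} → Increasing f → Contractive f →
              X ⊆ᵗ lifting em f Y → X ⊑ Y
  lifting⇒⊑ f-incr f-contr X⊆f̂Y = permutation⇒⊑ λ a a∈X →
    let g , g-inj , g∈χa = hall-marriage _ (χ-hallCondition f-incr f-contr X⊆f̂Y a a∈X)
    -- Distinct representatives are an injection of `Fin n` into itself, hence a permutation, and
    -- `g i` in `χ em Y (a i)` says that `a i` lies in `Y (g i)`.
    in  injective⇒permutation g g-inj , λ i → ∈-tabulate⁻ (λ j → em {Y j (a i)}) (g∈χa i)

proposition3 : ∀ {ℓ : Level} (em : ExcludedMiddle ℓ) (N : Set ℓ) (n : ℕ) (X Y : SubsetTuple N n) →
    AllNonempty X → AllNonempty Y →
    (X ⊑ Y) ⇔ (Σ[ f ∈ (Vec Bool n → Vec Bool n) ] Increasing f × Contractive f × (X ⊆ᵗ lifting em f Y))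
proposition3 em N n X Y X≢∅ _ = mk⇔
  (λ (X⊑Y : X ⊑ Y) → leastOperator em X Y , leastOperator-increasing em X Y ,
           leastOperator-contractive em X Y X≢∅ X⊑Y , ⊆-lifting-leastOperator em X Y)
  (λ (f , f-incr , f-contr , X⊆f̂Y) → lifting⇒⊑ em X Y f-incr f-contr X⊆f̂Y)
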